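{- Let $\mathcal G=\{G_0,\dots,G_{m-1}\}$ be an arbitrary metric grouping, indexed by non-increasing representative ratio, and let $$\omega:=\max_{k<k'}\Bigl(\max_{l\in G_{k'}}\rho_l-\min_{i\in G_k}\rho_i\Bigr)^{+}.$$ Then for any budget $0\le C<F^w_{[n]}$, $$E(C)\ \le\ \Delta_\Gamma(c^\star)+\omega C,$$ where $$\Delta_\Gamma(c^\star)\le U_\Gamma\Bigl(\widehat v_\Gamma\,\frac{w^+_\Gamma-w^-_\Gamma}{w^+_\Gamma+w^-_\Gamma}+\varepsilon_v\Bigr).$$ If $\omega=0$, the grouping is order-compatible, and the bound becomes $E(C)\le\Delta_\Gamma(c^\star)\le U_\Gamma\bigl(\widehat v_\Gamma\frac{w^+_\Gamma-w^-_\Gamma}{w^+_\Gamma+w^-_\Gamma}+\varepsilon_v\bigr)$.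
   Context: Instance: $[n]=\{0,\dots,n-1\}$; item $i$ has ceiling $u_i\in[0,1]$ and attribute $a_i$ in a metric space $(A,d)$; $v:A\to(0,v_{\max}]$ and $w:A\to[w_{\min},\infty)$, $w_{\min}>0$, are Lipschitz with constants $L_v,L_w$; $v_i=v(a_i)$, $w_i=w(a_i)$, $\rho_i=v_i/w_i$; budget $C\ge0$. For $S\subseteq[n]$, $U_S=\sum_{i\in S}u_i$, $F^w_S=\sum_{i\in S}w_iu_i$. $x^+=\max\{x,0\}$; the maximum over an empty set of pairs (case $m=1$) is $0$. The bounded fractional knapsack problem is $V^\star(C)=\max\sum_iv_iz_i$ over $z$ with $0\le z_i\le u_i$, $\sum_iw_iz_i\le C$. A metric grouping with tolerance $\delta>0$ is a partition $\mathcal G=\{G_0,\dots,G_{m-1}\}$ of $[n]$ into non-empty sets with representatives $\widehat a_k\in A$, $d(a_i,\widehat a_k)\le\delta$ for $i\in G_k$. Put $\widehat v_k=v(\widehat a_k)$, $\widehat\rho_k=v(\widehat a_k)/w(\widehat a_k)$, $w^-_k=\min_{i\in G_k}w_i$, $w^+_k=\max_{i\in G_k}w_i$, $\varepsilon_v=L_v\delta$; groups are indexed so that $\widehat\rho_0\ge\dots\ge\widehat\rho_{m-1}$. It is order-compatible if $\min_{i\in G_k}\rho_i\ge\max_{l\in G_{k'}}\rho_l$ for all $k<k'$. Grouped allocation: $F^w_{\le k}=\sum_{j\le k}F^w_{G_j}$, $F^w_{\le-1}=0$, $k^\star=\min\{k:F^w_{\le k}>C\}$, $c^\star=C-F^w_{\le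 k^\star-1}$, $\Gamma=G_{k^\star}$ (boundary group; subscript $\Gamma$ means the quantity for $k=k^\star$), $\Gamma^-=\bigcup_{j<k^\star}G_j$, $\Gamma^+=\bigcup_{j>k^\star}G_j$. For a group $G$ and $c\in[0,F^w_G]$, the water-filling allocation $z^{\mathrm{wf}}(c)\in\mathbb R^G$ is $z^{\mathrm{wf}}_i=\min\{u_i,\zeta\}$ with $\zeta\in[0,\max_{i\in G}u_i]$ the unique solution of $\sum_{i\in G}w_i\min\{u_i,\zeta\}=c$. Then $z^{\mathrm{gp}}_i=u_i$ on $\Gamma^-$, $z^{\mathrm{gp}}_i=0$ on $\Gamma^+$, and $z^{\mathrm{gp}}|_\Gamma=z^{\mathrm{wf}}(c^\star)$. $V^{\mathrm{gp}}(C)=\sum_iv_iz^{\mathrm{gp}}_i$ and $E(C)=V^\star(C)-V^{\mathrm{gp}}(C)$. Intra-group loss: $\Delta_G(c)=\max\{\sum_{i\in G}v_iz_i:0\le z_i\le u_i,\ \sum_{i\in G}w_iz_i\le c\}-\sum_{i\in G}v_iz^{\mathrm{wf}}_i(c)$. -}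

module Defs where

open import Level using (Level; suc; _⊔_)
open import Algebra.Bundles using (CommutativeRing)
open import Algebra.Core using (Op₁; Op₂)
open import Algebra.Structures using (IsCommutativeRing)
import Algebra.Construct.NaturalChoice.Max as NaturalMax
import Algebra.Construct.NaturalChoice.Min as NaturalMin
import Algebra.Definitions.RawMonoid as RawMonoidDefinitions
open import Data.Bool.Base using (if_then_else_)
open import Data.Fin.Base as Fin using (Fin)
open import Data.Fin.Properties using (_<?_; _≤?_; <-cmp)
open import Data.Fin.Subset using (Subset; _∈_; Nonempty; ⊤)
open import Data.Fin.Subset.Properties using (_∈?_)
open import Data.List.Base using (List; map; filter; allFin; cartesianProduct)
import Data.List.Extrema as Extrema
open import Data.Nat.Base using (ℕ)
open import Data.Product.Base using (∃; Σ-syntax; _×_; _,_; proj₁; proj₂)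
open import Function.Metric.Structures using (IsGeneralMetric)
open import Relation.Binary.Bundles using (TotalOrder; DecTotalOrder)
open import Relation.Binary.Core using (Rel)
open import Relation.Binary.Definitions using (tri<; tri≈; tri>)
open import Relation.Binary.PropositionalEquality.Core using (_≡_)
open import Relation.Binary.Structures using (IsDecTotalOrder)
import Relation.Binary.Construct.NonStrictToStrict as NonStrictToStrict
open import Relation.Nullary using (¬_)
open import Relation.Nullary.Decidable using (does)
open import Relation.Unary using (Pred; Decidable)

-- Linearly ordered fields stand in for ℝ, which is (classically) one of
-- them: only the field operations and the order occur in the theory
-- below.  The inverse is total; its value at 0# is unspecified and is
-- never used.
record OrderedField c ℓ₁ ℓ₂ : Set (suc (c ⊔ ℓ₁ ⊔ ℓ₂)) where
  infix  8 _⁻¹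
  infixl 7 _*_
  infixl 6 _+_
  infix  4 _≈_ _≤_
  field
    Carrier           : Set c
    _≈_               : Rel Carrier ℓ₁
    _≤_               : Rel Carrier ℓ₂
    _+_ _*_           : Op₂ Carrier
    -_                : Op₁ Carrier
    _⁻¹               : Op₁ Carrier
    0# 1#             : Carrier
    isCommutativeRing : IsCommutativeRing _≈_ _+_ _*_ -_ 0# 1#
    isDecTotalOrder   : IsDecTotalOrder _≈_ _≤_
    0≉1               : ¬ (0# ≈ 1#)
    ⁻¹-inverseʳ       : ∀ {x} → ¬ (x ≈ 0#) → x * x ⁻¹ ≈ 1#
    +-monoˡ-≤         : ∀ z {x y} → x ≤ y → x + z ≤ y + z
    *-nonNegative     : ∀ {x y} → 0# ≤ x → 0# ≤ y → 0# ≤ x * y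

  commutativeRing : CommutativeRing c ℓ₁
  commutativeRing = record { isCommutativeRing = isCommutativeRing }

  decTotalOrder : DecTotalOrder c ℓ₁ ℓ₂
  decTotalOrder = record { isDecTotalOrder = isDecTotalOrder }

  totalOrder : TotalOrder c ℓ₁ ℓ₂
  totalOrder = DecTotalOrder.totalOrder decTotalOrder

  open NonStrictToStrict _≈_ _≤_ public using (_<_)
  open NaturalMax totalOrder public using () renaming (_⊔_ to _∨_)
  open NaturalMin totalOrder public using () renaming (_⊓_ to _∧_)
  open Extrema totalOrder public using (min; max)
  open RawMonoidDefinitions
    (CommutativeRing.+-rawMonoid commutativeRing) public using (sum)

  infixl 7 _÷_
  infixl 6 _-_
  infix  9 _⁺

  _-_ : Op₂ Carrier
  x - y = x + (- y)

  _÷_ : Op₂ Carrier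
  x ÷ y = x * y ⁻¹

  _⁺ : Op₁ Carrier
  x ⁺ = x ∨ 0#

  ∣_∣ : Op₁ Carrier
  ∣ x ∣ = x ∨ (- x)

  ∑ : ∀ {n p} {P : Pred (Fin n) p} → Decidable P → (Fin n → Carrier) → Carrier
  ∑ P? f = sum (λ i → if does (P? i) then f i else 0#)

  -- The extrema functions of Data.List.Extrema take a starting value;
  -- here it is the value at a member of S, so it does not affect the result.
  minOver maxOver : ∀ {n} (S : Subset n) → Nonempty S →
                    (Fin n → Carrier) → Carrier
  minOver {n} S (i , _) f = min (f i) (map f (filter (_∈? S) (allFin n)))
  maxOver {n} S (i , _) f = max (f i) (map f (filter (_∈? S) (allFin n)))

module _ {c ℓ₁ ℓ₂} (K : OrderedField c ℓ₁ ℓ₂) where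
  open OrderedField K

  -- The constant is required to be nonnegative, which the bound alone
  -- does not force when A is a single point.
  record Lipschitz {a} {A : Set a} (d : A → A → Carrier)
                   (L : Carrier) (f : A → Carrier) : Set (a ⊔ ℓ₂) where
    field
      0≤L   : 0# ≤ L
      bound : ∀ x y → ∣ f x - f y ∣ ≤ L * d x y

  record Instance (a ℓ : Level) : Set (suc (a ⊔ ℓ) ⊔ c ⊔ ℓ₁ ⊔ ℓ₂) where
    infix 4 _≈ₐ_
    field
      A               : Set a
      _≈ₐ_            : Rel A ℓ
      d               : A → A → Carrier
      isMetric        : IsGeneralMetric _≈ₐ_ _≈_ _≤_ 0# _+_ d
      v w             : A → Carrier
      v-max w-min     : Carrier
      L-v L-w         : Carrier
      0<v             : ∀ x → 0# < v x
      v≤v-max         : ∀ x → v x ≤ v-max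
      0<w-min         : 0# < w-min
      w-min≤w         : ∀ x → w-min ≤ w x
      v-lipschitz     : Lipschitz d L-v v
      w-lipschitz     : Lipschitz d L-w w
      n               : ℕ
      u               : Fin n → Carrier
      0≤u             : ∀ i → 0# ≤ u i
      u≤1             : ∀ i → u i ≤ 1#
      attr            : Fin n → A

    vᵢ wᵢ ρᵢ : Fin n → Carrier
    vᵢ i = v (attr i)
    wᵢ i = w (attr i)
    ρᵢ i = vᵢ i ÷ wᵢ i

    U : Subset n → Carrier
    U S = ∑ (_∈? S) u

    F : Subset n → Carrier
    F S = ∑ (_∈? S) (λ i → wᵢ i * u i)

    value weight : Subset n → (Fin n → Carrier) → Carrier
    value  S z = ∑ (_∈? S) (λ i → vᵢ i * z i)
    weight S z = ∑ (_∈? S) (λ i → wᵢ i * z i)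

    -- The bounded fractional knapsack problem on the items of S; the
    -- entries of z outside S are irrelevant.
    record Feasible (S : Subset n) (C : Carrier) (z : Fin n → Carrier) :
                    Set ℓ₂ where
      field
        0≤z    : ∀ {i} → i ∈ S → 0# ≤ z i
        z≤u    : ∀ {i} → i ∈ S → z i ≤ u i
        budget : weight S z ≤ C

    record IsKnapsackMax (S : Subset n) (C V : Carrier) :
                         Set (c ⊔ ℓ₁ ⊔ ℓ₂) where
      field
        attained   : Σ[ z ∈ (Fin n → Carrier) ] Feasible S C z × value S z ≈ V
        upperBound : ∀ z → Feasible S C z → value S z ≤ V

    waterFilling : Carrier → Fin n → Carrier
    waterFilling ζ i = u i ∧ ζ

    record IsWaterLevel (S : Subset n) (S≢∅ : Nonempty S)
                        (C ζ : Carrier) : Set (ℓ₁ ⊔ ℓ₂) where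
      field
        0≤ζ    : 0# ≤ ζ
        ζ≤maxu : ζ ≤ maxOver S S≢∅ u
        level  : weight S (waterFilling ζ) ≈ C

  record MetricGrouping {a ℓ} (I : Instance a ℓ) (δ : Carrier) :
                        Set (a ⊔ c ⊔ ℓ₁ ⊔ ℓ₂) where
    open Instance I
    field
      0<δ      : 0# < δ
      m        : ℕ
      G        : Fin m → Subset n
      nonempty : ∀ k → Nonempty (G k)
      cover    : ∀ i → ∃ λ k → i ∈ G k
      disjoint : ∀ {i k k′} → i ∈ G k → i ∈ G k′ → k ≡ k′
      rep      : Fin m → A
      close    : ∀ {i k} → i ∈ G k → d (attr i) (rep k) ≤ δ

    v̂ : Fin m → Carrier
    v̂ k = v (rep k)

    ρ̂ : Fin m → Carrier
    ρ̂ k = v (rep k) ÷ w (rep k)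

    field
      sorted   : ∀ {k k′} → k Fin.≤ k′ → ρ̂ k′ ≤ ρ̂ k

    groupOf : Fin n → Fin m
    groupOf i = proj₁ (cover i)

    minOn maxOn : Fin m → (Fin n → Carrier) → Carrier
    minOn k = minOver (G k) (nonempty k)
    maxOn k = maxOver (G k) (nonempty k)

    w⁻ w⁺ : Fin m → Carrier
    w⁻ k = minOn k wᵢ
    w⁺ k = maxOn k wᵢ

    ε-v : Carrier
    ε-v = L-v * δ

    OrderCompatible : Set ℓ₂
    OrderCompatible = ∀ {k k′} → k Fin.< k′ → maxOn k′ ρᵢ ≤ minOn k ρᵢ

    increasingPairs : List (Fin m × Fin m)
    increasingPairs = filter (λ p → proj₁ p <? proj₂ p)
                             (cartesianProduct (allFin m) (allFin m))

    -- The starting value 0# is the maximum over no pairs, and is otherwise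
    -- dominated by the positive parts.
    ω : Carrier
    ω = max 0# (map (λ (k , k′) → (maxOn k′ ρᵢ - minOn k ρᵢ) ⁺) increasingPairs)

    -- F≤ k and F< k are the cumulative weights up to and including group k
    -- and up to the group before it; F< k is 0# for the first group.
    F≤ F< : Fin m → Carrier
    F≤ k = ∑ (_≤? k) (λ j → F (G j))
    F< k = ∑ (_<? k) (λ j → F (G j))

    -- The boundary group and its water level, which together determine the
    -- grouped allocation at budget C.
    record GroupedAllocation (C : Carrier) : Set (c ⊔ ℓ₁ ⊔ ℓ₂) where
      field
        k⋆         : Fin m
        exceeds    : C < F≤ k⋆
        least   : ∀ k → C < F≤ k → k⋆ Fin.≤ k

      c⋆ : Carrier
      c⋆ = C - F< k⋆

      Γ : Subset n
      Γ = G k⋆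

      field
        ζ            : Carrier
        isWaterLevel : IsWaterLevel Γ (nonempty k⋆) c⋆ ζ

      zᵍᵖ : Fin n → Carrier
      zᵍᵖ i with <-cmp (groupOf i) k⋆
      ... | tri< _ _ _ = u i
      ... | tri≈ _ _ _ = waterFilling ζ i
      ... | tri> _ _ _ = 0#

      Vᵍᵖ : Carrier
      Vᵍᵖ = value ⊤ zᵍᵖ

      -- E and ΔΓ take the optimal value of the respective knapsack problem
      -- as an argument; it is pinned down by IsKnapsackMax ⊤ C and
      -- IsKnapsackMax Γ c⋆.
      E : Carrier → Carrier
      E V⋆ = V⋆ - Vᵍᵖ

      ΔΓ : Carrier → Carrier
      ΔΓ VΓ = VΓ - value Γ (waterFilling ζ)

      ΔΓ-bound : Carrier
      ΔΓ-bound = U Γ * (v̂ k⋆ * ((w⁺ k⋆ - w⁻ k⋆) ÷ (w⁺ k⋆ + w⁻ k⋆)) + ε-v)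

{-# OPTIONS --safe #-}
-- Both bounds come from one weak-duality step.  If z is feasible and y
-- exhausts the same budget, then for every price τ ≥ 0 of a unit of weight the
-- value of z exceeds that of y by at most the sum of the errors made in pricing
-- v i at τ w i.  Inside the boundary group, y is water filling and
-- τ = 2 v̂ / (w⁺ + w⁻).  For the whole instance, y fills the groups in order,
-- with a suitable allocation on the boundary group; τ is the smallest ratio up
-- to the boundary or the largest ratio from it on, so that only items on the
-- other side are mispriced, each by at most ω per unit of weight.
module Submission where

open import Defs
open import Level using (Level)
open import Algebra.Bundles using (CommutativeRing)
import Algebra.Construct.NaturalChoice.Max as NaturalMax
import Algebra.Construct.NaturalChoice.Min as NaturalMin
import Algebra.Properties.Ring as RingProperties
import Algebra.Properties.Semiring.Sum as SemiringSum
import Algebra.Solver.Ring.NaturalCoefficients.Default as Solver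
open import Data.Bool.Base using (if_then_else_)
open import Data.Fin.Base as Fin using (Fin; punchIn)
open import Data.Fin.Properties using (_<?_; _≤?_; <-cmp; punchInᵢ≢i)
open import Data.Fin.Subset using (Subset; _∈_; Nonempty; ⊤)
open import Data.Fin.Subset.Properties using (_∈?_; ∈⊤)
open import Data.List.Base using (allFin; filter; map)
import Data.List.Extrema as Extrema
open import Data.List.Membership.Propositional.Properties
  using (∈-map⁺; ∈-filter⁺; ∈-cartesianProduct⁺; ∈-allFin)
open import Data.List.Relation.Unary.All using (lookup; tabulate)
open import Data.List.Relation.Unary.All.Properties using (all-filter; map⁺)
open import Data.Nat.Base as ℕ using (ℕ; suc)
import Data.Nat.Properties as ℕ
open import Data.Product.Base using (∃; _×_; _,_; proj₁; proj₂)
open import Data.Sum.Base using (inj₁; inj₂; [_,_]′)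
open import Function.Base using (_∘_; const)
open import Relation.Binary.Bundles using (DecTotalOrder; TotalOrder)
open import Relation.Binary.Definitions using (tri<; tri≈; tri>)
open import Relation.Binary.PropositionalEquality.Core as ≡
  using (_≡_; _≢_)
import Relation.Binary.Reasoning.PartialOrder as PartialOrderReasoning
open import Relation.Nullary using (Dec; yes; no; ¬_; contradiction)
open import Relation.Nullary.Decidable using (does)
open import Relation.Unary using (Pred; Decidable)

-- Arithmetic of ordered fields

module OrderedFieldProperties {c ℓ₁ ℓ₂} (K : OrderedField c ℓ₁ ℓ₂) where
  open OrderedField K
  open CommutativeRing commutativeRing public using
    ( refl; reflexive; sym; trans; +-cong; +-congˡ; +-congʳ; *-cong; *-congˡ; *-congʳ
    ; +-assoc; +-comm; +-identityˡ; +-identityʳ; *-assoc; *-comm; *-identityˡ; *-identityʳ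
    ; zeroˡ; zeroʳ; -‿inverseˡ; -‿inverseʳ; -‿cong; distribˡ; distribʳ; commutativeSemiring; ring; semiring )
  open TotalOrder totalOrder public using (poset; total; antisym)
    renaming (refl to ≤-refl; reflexive to ≤-reflexive; trans to ≤-trans)
  open RingProperties ring using (-‿distribˡ-*; -‿involutive)
  open Solver commutativeSemiring using (solve; _:=_; _:+_; _:*_)
  open SemiringSum semiring using
    (sum-cong-≋; sum-remove; sum-replicate-zero; ∑-distrib-+; ∑-comm; *-distribˡ-sum)
  module ≤-Reasoning = PartialOrderReasoning poset
  open ≤-Reasoning

  private variable
    x y z s t a b : Carrier

  +-mono-≤ : x ≤ y → s ≤ t → x + s ≤ y + t
  +-mono-≤ {x} {y} {s} {t} x≤y s≤t = begin
    x + s ≤⟨ +-monoˡ-≤ s x≤y ⟩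
    y + s ≈⟨ +-comm y s ⟩
    s + y ≤⟨ +-monoˡ-≤ y s≤t ⟩
    t + y ≈⟨ +-comm t y ⟩
    y + t ∎

  +-cancelʳ-≤ : ∀ z → x + z ≤ y + z → x ≤ y
  +-cancelʳ-≤ {x} {y} z x+z≤y+z = begin
    x             ≈⟨ undo x ⟨
    x + z + - z   ≤⟨ +-monoˡ-≤ (- z) x+z≤y+z ⟩
    y + z + - z   ≈⟨ undo y ⟩
    y             ∎
    where
    undo : ∀ x → x + z + - z ≈ x
    undo x = trans (+-assoc x z (- z)) (trans (+-congˡ (-‿inverseʳ z)) (+-identityʳ x))

  y≈x+[y-x] : ∀ x y → y ≈ x + (y - x)
  y≈x+[y-x] x y = begin-equality
    y               ≈⟨ +-identityʳ y ⟨
    y + 0#          ≈⟨ +-congˡ (-‿inverseˡ x) ⟨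
    y + (- x + x)   ≈⟨ solve 3 (λ x y n → y :+ (n :+ x) := x :+ (y :+ n)) refl x y (- x) ⟩
    x + (y - x)     ∎

  0≤y-x : x ≤ y → 0# ≤ y - x
  0≤y-x {x} {y} x≤y = begin
    0#    ≈⟨ -‿inverseʳ x ⟨
    x - x ≤⟨ +-monoˡ-≤ (- x) x≤y ⟩
    y - x ∎

  x≤y+z⇒x-y≤z : x ≤ y + z → x - y ≤ z
  x≤y+z⇒x-y≤z {x} {y} {z} x≤y+z = +-cancelʳ-≤ y (begin
    (x - y) + y   ≈⟨ +-comm _ y ⟩
    y + (x - y)   ≈⟨ y≈x+[y-x] y x ⟨
    x             ≤⟨ x≤y+z ⟩
    y + z         ≈⟨ +-comm y z ⟩
    z + y         ∎)

  x-y≤z⇒x≤y+z : x - y ≤ z → x ≤ y + z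
  x-y≤z⇒x≤y+z {x} {y} {z} x-y≤z = begin
    x             ≈⟨ y≈x+[y-x] y x ⟩
    y + (x - y)   ≤⟨ +-mono-≤ ≤-refl x-y≤z ⟩
    y + z         ∎

  x≤x+y : 0# ≤ y → x ≤ x + y
  x≤x+y {y} {x} 0≤y = begin
    x      ≈⟨ +-identityʳ x ⟨
    x + 0# ≤⟨ +-mono-≤ ≤-refl 0≤y ⟩
    x + y  ∎

  *-monoˡ-≤ : 0# ≤ z → x ≤ y → z * x ≤ z * y
  *-monoˡ-≤ {z} {x} {y} 0≤z x≤y = begin
    z * x               ≤⟨ x≤x+y (*-nonNegative 0≤z (0≤y-x x≤y)) ⟩
    z * x + z * (y - x) ≈⟨ distribˡ z x (y - x) ⟨
    z * (x + (y - x))   ≈⟨ *-congˡ (y≈x+[y-x] x y) ⟨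
    z * y               ∎

  *-monoʳ-≤ : 0# ≤ z → x ≤ y → x * z ≤ y * z
  *-monoʳ-≤ {z} {x} {y} 0≤z x≤y = begin
    x * z ≈⟨ *-comm x z ⟩
    z * x ≤⟨ *-monoˡ-≤ 0≤z x≤y ⟩
    z * y ≈⟨ *-comm z y ⟩
    y * z ∎

  -- The two sides differ by `(b - a) * (y - x)`, a product of nonnegative factors.
  rearrangement : a ≤ b → x ≤ y → a * y + b * x ≤ a * x + b * y
  rearrangement {a} {b} {x} {y} a≤b x≤y = begin
    a * y + b * x               ≈⟨ +-cong (*-congˡ (y≈x+[y-x] x y)) (*-congʳ (y≈x+[y-x] a b)) ⟩
    a * (x + q) + (a + p) * x   ≤⟨ x≤x+y (*-nonNegative (0≤y-x a≤b) (0≤y-x x≤y)) ⟩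
    a * (x + q) + (a + p) * x + p * q
      ≈⟨ solve 4 (λ a x p q → a :* (x :+ q) :+ (a :+ p) :* x :+ p :* q
                           := a :* x :+ (a :+ p) :* (x :+ q)) refl a x p q ⟩
    a * x + (a + p) * (x + q)   ≈⟨ +-congˡ (*-cong (y≈x+[y-x] a b) (y≈x+[y-x] x y)) ⟨
    a * x + b * y               ∎
    where
    p = b - a
    q = y - x

  0≤-x : x ≤ 0# → 0# ≤ - x
  0≤-x {x} x≤0 = begin
    0#     ≤⟨ 0≤y-x x≤0 ⟩
    0# - x ≈⟨ +-identityˡ (- x) ⟩
    - x    ∎

  -- If `1#` were at most zero, `- 1#` would be nonnegative, and so would its square, which is `1#`
  -- again.
  0≤1 : 0# ≤ 1#
  0≤1 with total 0# 1#
  ... | inj₁ 0≤1 = 0≤1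
  ... | inj₂ 1≤0 = begin
    0#            ≤⟨ *-nonNegative (0≤-x 1≤0) (0≤-x 1≤0) ⟩
    - 1# * - 1#   ≈⟨ -‿distribˡ-* 1# (- 1#) ⟨
    - (1# * - 1#) ≈⟨ -‿cong (*-identityˡ (- 1#)) ⟩
    - (- 1#)      ≈⟨ -‿involutive 1# ⟩
    1#            ∎

  0<x⇒x*x⁻¹≈1 : 0# < x → x * x ⁻¹ ≈ 1#
  0<x⇒x*x⁻¹≈1 (_ , 0≉x) = ⁻¹-inverseʳ (0≉x ∘ sym)

  0≤x⁻¹ : 0# < x → 0# ≤ x ⁻¹
  0≤x⁻¹ {x} 0<x@(0≤x , _) with total 0# (x ⁻¹)
  ... | inj₁ 0≤x⁻¹ = 0≤x⁻¹
  ... | inj₂ x⁻¹≤0 = contradiction (antisym 0≤1 1≤0) 0≉1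
    where
    1≤0 : 1# ≤ 0#
    1≤0 = begin
      1#       ≈⟨ 0<x⇒x*x⁻¹≈1 0<x ⟨
      x * x ⁻¹ ≤⟨ *-monoˡ-≤ 0≤x x⁻¹≤0 ⟩
      x * 0#   ≈⟨ zeroʳ x ⟩
      0#       ∎

  ÷-*-cancel : 0# < y → (x ÷ y) * y ≈ x
  ÷-*-cancel {y} {x} 0<y = begin-equality
    x * y ⁻¹ * y   ≈⟨ solve 3 (λ x y i → x :* i :* y := x :* (y :* i)) refl x y (y ⁻¹) ⟩
    x * (y * y ⁻¹) ≈⟨ *-congˡ (0<x⇒x*x⁻¹≈1 0<y) ⟩
    x * 1#         ≈⟨ *-identityʳ x ⟩
    x              ∎

  x≤∣x∣ : ∀ x → x ≤ ∣ x ∣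
  x≤∣x∣ x = NaturalMax.x≤x⊔y totalOrder x (- x)

  -x≤∣x∣ : ∀ x → - x ≤ ∣ x ∣
  -x≤∣x∣ x = NaturalMax.x≤y⊔x totalOrder x (- x)

  ∣x-y∣≤z⇒x≤y+z : ∣ x - y ∣ ≤ z → x ≤ y + z
  ∣x-y∣≤z⇒x≤y+z {x} {y} ∣x-y∣≤z = x-y≤z⇒x≤y+z (≤-trans (x≤∣x∣ (x - y)) ∣x-y∣≤z)

  ∣x-y∣≤z⇒y≤x+z : ∣ x - y ∣ ≤ z → y ≤ x + z
  ∣x-y∣≤z⇒y≤x+z {x} {y} {z} ∣x-y∣≤z = begin
    y                         ≈⟨ +-identityʳ y ⟨
    y + 0#                    ≈⟨ +-congˡ (-‿inverseʳ (x - y)) ⟨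
    y + ((x - y) + - (x - y)) ≈⟨ +-assoc y (x - y) (- (x - y)) ⟨
    y + (x - y) + - (x - y)   ≈⟨ +-congʳ (y≈x+[y-x] y x) ⟨
    x + - (x - y)             ≤⟨ +-mono-≤ ≤-refl (-x≤∣x∣ (x - y)) ⟩
    x + ∣ x - y ∣             ≤⟨ +-mono-≤ ≤-refl ∣x-y∣≤z ⟩
    x + z                     ∎

  -- Each endpoint is weighted by the distance of `x` to the other one, divided by the length of the
  -- interval. An interval of length zero is treated separately, since there the inverse has no
  -- specified value.
  ∃-convexCombination : a ≤ x → x ≤ b →
    ∃ λ σ → ∃ λ θ → 0# ≤ σ × 0# ≤ θ × σ + θ ≈ 1# × σ * a + θ * b ≈ x
  ∃-convexCombination {a} {x} {b} a≤x x≤b = by-cases (a ≟ b)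
    where
    open DecTotalOrder decTotalOrder using (_≟_)
    p = x - a
    q = b - x
    by-cases : Dec (a ≈ b) → ∃ λ σ → ∃ λ θ → 0# ≤ σ × 0# ≤ θ × σ + θ ≈ 1# × σ * a + θ * b ≈ x
    by-cases (yes a≈b) = 1# , 0# , 0≤1 , ≤-refl , +-identityʳ 1# , (begin-equality
      1# * a + 0# * b ≈⟨ +-cong (*-identityˡ a) (zeroˡ b) ⟩
      a + 0#          ≈⟨ +-identityʳ a ⟩
      a               ≈⟨ antisym a≤x (≤-trans x≤b (≤-reflexive (sym a≈b))) ⟩
      x               ∎)
    by-cases (no a≉b) =
      q ÷ g , p ÷ g , *-nonNegative (0≤y-x x≤b) 0≤g⁻¹ , *-nonNegative (0≤y-x a≤x) 0≤g⁻¹ ,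
      (begin-equality
        q * g ⁻¹ + p * g ⁻¹ ≈⟨ solve 3 (λ p q i → q :* i :+ p :* i := (p :+ q) :* i) refl p q (g ⁻¹) ⟩
        (p + q) * g ⁻¹      ≈⟨ 0<x⇒x*x⁻¹≈1 0<g ⟩
        1#                  ∎) ,
      (begin-equality
        q * g ⁻¹ * a + p * g ⁻¹ * b         ≈⟨ +-congˡ (*-congˡ b≈a+g) ⟩
        q * g ⁻¹ * a + p * g ⁻¹ * (a + g)
          ≈⟨ solve 4 (λ a p q i → q :* i :* a :+ p :* i :* (a :+ (p :+ q))
                               := (a :+ p) :* ((p :+ q) :* i)) refl a p q (g ⁻¹) ⟩
        (a + p) * (g * g ⁻¹)                ≈⟨ *-cong (sym (y≈x+[y-x] a x)) (0<x⇒x*x⁻¹≈1 0<g) ⟩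
        x * 1#                              ≈⟨ *-identityʳ x ⟩
        x                                   ∎)
      where
      -- With the length written as `p + q` instead of `b - a`, the two coefficients sum to one
      -- after factoring out `g ⁻¹` and cancelling.
      g = p + q
      b≈a+g : b ≈ a + g
      b≈a+g = begin-equality
        b           ≈⟨ y≈x+[y-x] x b ⟩
        x + q       ≈⟨ +-congʳ (y≈x+[y-x] a x) ⟩
        a + p + q   ≈⟨ +-assoc a p q ⟩
        a + g       ∎
      0<g : 0# < g
      0<g = ≤-trans (0≤y-x a≤x) (x≤x+y (0≤y-x x≤b)) ,
            λ 0≈g → a≉b (trans (sym (+-identityʳ a)) (trans (+-congˡ 0≈g) (sym b≈a+g)))
      0≤g⁻¹ = 0≤x⁻¹ 0<g

  module _ (σ+θ≈1 : s + t ≈ 1#) (x≤y : x ≤ y) where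
    private
      expand : ∀ z → z ≈ s * z + t * z
      expand z = begin-equality
        z             ≈⟨ *-identityˡ z ⟨
        1# * z        ≈⟨ *-congʳ σ+θ≈1 ⟨
        (s + t) * z   ≈⟨ solve 3 (λ s t z → (s :+ t) :* z := s :* z :+ t :* z) refl s t z ⟩
        s * z + t * z ∎

    lower≤convex : 0# ≤ t → x ≤ s * x + t * y
    lower≤convex 0≤t = begin
      x             ≈⟨ expand x ⟩
      s * x + t * x ≤⟨ +-mono-≤ ≤-refl (*-monoˡ-≤ 0≤t x≤y) ⟩
      s * x + t * y ∎

    convex≤upper : 0# ≤ s → s * x + t * y ≤ y
    convex≤upper 0≤s = begin
      s * x + t * y ≤⟨ +-mono-≤ (*-monoˡ-≤ 0≤s x≤y) ≤-refl ⟩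
      s * y + t * y ≈⟨ expand y ⟨
      y             ∎

  -- Sums over decidable predicates

  private variable
    p q : Level
    n : ℕ

  if-yes : ∀ {P : Set p} (P? : Dec P) → P → (if does P? then x else 0#) ≈ x
  if-yes (yes _) _ = refl
  if-yes (no ¬p) p = contradiction p ¬p

  if-no : ∀ {P : Set p} (P? : Dec P) → ¬ P → (if does P? then x else 0#) ≈ 0#
  if-no (yes p) ¬p = contradiction p ¬p
  if-no (no _)  _  = refl

  sum-mono-≤ : ∀ {n} {f g : Fin n → Carrier} → (∀ i → f i ≤ g i) → sum f ≤ sum g
  sum-mono-≤ {ℕ.zero}  f≤g = ≤-refl
  sum-mono-≤ {suc n} f≤g = +-mono-≤ (f≤g Fin.zero) (sum-mono-≤ (f≤g ∘ Fin.suc))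

  sum-single : ∀ {n} {f : Fin n → Carrier} i → (∀ {j} → j ≢ i → f j ≈ 0#) → sum f ≈ f i
  sum-single {suc n} {f} i f≈0 = begin-equality
    sum f                            ≈⟨ sum-remove {i = i} f ⟩
    f i + sum (f ∘ punchIn i)        ≈⟨ +-congˡ (sum-cong-≋ (λ j → f≈0 (punchInᵢ≢i i j))) ⟩
    f i + sum (const {B = Fin n} 0#) ≈⟨ +-congˡ (sum-replicate-zero n) ⟩
    f i + 0#                         ≈⟨ +-identityʳ (f i) ⟩
    f i                              ∎

  module _ {n} {P : Pred (Fin n) p} (P? : Decidable P) where
    private variable
      f g : Fin n → Carrier

    ∑-mono-≤ : (∀ {i} → P i → f i ≤ g i) → ∑ P? f ≤ ∑ P? g
    ∑-mono-≤ f≤g = sum-mono-≤ λ i → pointwise i (P? i)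
      where
      pointwise : ∀ i (Pi? : Dec (P i)) → (if does Pi? then _ else 0#) ≤ (if does Pi? then _ else 0#)
      pointwise i (yes Pi) = f≤g Pi
      pointwise i (no _)   = ≤-refl

    ∑-cong : (∀ {i} → P i → f i ≈ g i) → ∑ P? f ≈ ∑ P? g
    ∑-cong f≈g = antisym (∑-mono-≤ (≤-reflexive ∘ f≈g)) (∑-mono-≤ (≤-reflexive ∘ sym ∘ f≈g))

    ∑-+ : ∀ f g → ∑ P? (λ i → f i + g i) ≈ ∑ P? f + ∑ P? g
    ∑-+ f g = trans (sum-cong-≋ λ i → pointwise i (P? i)) (∑-distrib-+
        (λ i → if does (P? i) then f i else 0#) (λ i → if does (P? i) then g i else 0#))
      where
      pointwise : ∀ i (Pi? : Dec (P i)) → (if does Pi? then f i + g i else 0#) ≈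
        (if does Pi? then f i else 0#) + (if does Pi? then g i else 0#)
      pointwise i (yes _) = refl
      pointwise i (no _)  = sym (+-identityʳ 0#)

    ∑-*ˡ : ∀ x f → ∑ P? (λ i → x * f i) ≈ x * ∑ P? f
    ∑-*ˡ x f = trans (sum-cong-≋ λ i → pointwise i (P? i))
      (sym (*-distribˡ-sum x (λ i → if does (P? i) then f i else 0#)))
      where
      pointwise : ∀ i (Pi? : Dec (P i)) → (if does Pi? then x * f i else 0#) ≈
        x * (if does Pi? then f i else 0#)
      pointwise i (yes _) = refl
      pointwise i (no _)  = sym (zeroʳ x)

  ∑-⊤ : ∀ {n} (f : Fin n → Carrier) → ∑ (_∈? ⊤) f ≈ sum f
  ∑-⊤ {n} f = sum-cong-≋ {n} {λ i → if does (i ∈? ⊤) then f i else 0#} {f} λ i → if-yes (i ∈? ⊤) ∈⊤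

  -- Double counting: after the two sums are interchanged, the inner sum over groups has a single
  -- possibly nonzero term, at `g i`.
  ∑-fibres : ∀ {m n} {Q : Pred (Fin m) q} (Q? : Decidable Q) (G : Fin m → Subset n)
             (g : Fin n → Fin m) → (∀ i → i ∈ G (g i)) → (∀ {i k} → i ∈ G k → k ≡ g i) →
             ∀ f → ∑ Q? (λ k → ∑ (_∈? G k) f) ≈ ∑ (Q? ∘ g) f
  ∑-fibres {m = m} {n} Q? G g i∈Gg unique f = begin-equality
    sum (λ k → if does (Q? k) then sum (λ i → if does (i ∈? G k) then f i else 0#) else 0#)
      ≈⟨ sum-cong-≋ (λ k → push (Q? k)) ⟩
    sum (λ k → sum (λ i → term k i))
      ≈⟨ ∑-comm {m} {n} term ⟩
    sum (λ i → sum (λ k → term k i))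
      ≈⟨ sum-cong-≋ (λ i → sum-single (g i) (vanish i)) ⟩
    sum (λ i → term (g i) i)
      ≈⟨ sum-cong-≋ (λ i → keep i (Q? (g i))) ⟩
    ∑ (Q? ∘ g) f ∎
    where
    term : Fin m → Fin n → Carrier
    term k i = if does (Q? k) then (if does (i ∈? G k) then f i else 0#) else 0#
    push : ∀ {Q : Set _} (Q? : Dec Q) {h : Fin n → Carrier} →
           (if does Q? then sum h else 0#) ≈ sum (λ i → if does Q? then h i else 0#)
    push (yes _) = refl
    push (no _)  = sym (sum-replicate-zero n)
    vanish : ∀ i {k} → k ≢ g i → term k i ≈ 0#
    vanish i {k} k≢gi with Q? k
    ... | yes _ = if-no (i ∈? G k) (k≢gi ∘ unique)
    ... | no _  = refl
    keep : ∀ i {Q : Set _} (Q? : Dec Q) →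
           (if does Q? then (if does (i ∈? G (g i)) then f i else 0#) else 0#) ≈
           (if does Q? then f i else 0#)
    keep i (yes _) = if-yes (i ∈? G (g i)) (i∈Gg i)
    keep i (no _)  = refl

  -- Extremal indices and extremal values

  module _ {n} {P : Pred (Fin n) p} (P? : Decidable P) (f : Fin n → Carrier) where
    open Extrema totalOrder

    -- An index that attains the minimum is returned rather than the value: the prices chosen later
    -- must be ratios of actual items, whose groups can then be compared with others.
    ∃-minimiser : ∃ P → ∃ λ i → P i × (∀ {j} → P j → f i ≤ f j)
    ∃-minimiser (i , Pi) = argmin f i xs , argmin-all f Pi (all-filter P? (allFin n)) ,
      λ {j} Pj → lookup (f[argmin]≤f[xs] {f = f} i xs) (∈-filter⁺ P? (∈-allFin j) Pj)
      where xs = filter P? (allFin n)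

    ∃-maximiser : ∃ P → ∃ λ i → P i × (∀ {j} → P j → f j ≤ f i)
    ∃-maximiser (i , Pi) = argmax f i xs , argmax-all f Pi (all-filter P? (allFin n)) ,
      λ {j} Pj → lookup (f[xs]≤f[argmax] {f = f} i xs) (∈-filter⁺ P? (∈-allFin j) Pj)
      where xs = filter P? (allFin n)

  module _ {n} {S : Subset n} (S≢∅ : Nonempty S) (f : Fin n → Carrier) where
    open Extrema totalOrder using (min≤xs; xs≤max; v≤min⁺)

    minOver≤ : ∀ {i} → i ∈ S → minOver S S≢∅ f ≤ f i
    minOver≤ {i} i∈S = lookup (min≤xs _ _) (∈-map⁺ f (∈-filter⁺ (_∈? S) (∈-allFin i) i∈S))

    ≤maxOver : ∀ {i} → i ∈ S → f i ≤ maxOver S S≢∅ f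
    ≤maxOver {i} i∈S = lookup (xs≤max _ _) (∈-map⁺ f (∈-filter⁺ (_∈? S) (∈-allFin i) i∈S))

    ≤minOver : (∀ i → x ≤ f i) → x ≤ minOver S S≢∅ f
    ≤minOver x≤f = v≤min⁺ (x≤f (proj₁ S≢∅))
      (map⁺ (tabulate {xs = filter (_∈? S) (allFin n)} λ _ → x≤f _))

  -- Pricing errors of a single item

  module _ {v τ ε : Carrier} (0≤ε : 0# ≤ ε) where
    -- Lowering `y` to `z` saves `τ` and forgoes `v` per unit, a net gain of `(τ - v) * (y - z)`.
    -- This is at most `ε * (y - z)`, hence at most `ε * y`.
    decrease-priced : τ ≤ v + ε → z ≤ y → 0# ≤ z → v * z + τ * y ≤ v * y + τ * z + ε * y
    decrease-priced {z} {y} τ≤v+ε z≤y 0≤z = begin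
      v * z + τ * y             ≤⟨ x≤x+y (*-nonNegative 0≤ε 0≤z) ⟩
      v * z + τ * y + ε * z
        ≈⟨ solve 5 (λ v τ e z y → v :* z :+ τ :* y :+ e :* z := τ :* y :+ (v :+ e) :* z) refl v τ ε z y ⟩
      τ * y + (v + ε) * z       ≤⟨ rearrangement τ≤v+ε z≤y ⟩
      τ * z + (v + ε) * y
        ≈⟨ solve 5 (λ v τ e z y → τ :* z :+ (v :+ e) :* y := v :* y :+ τ :* z :+ e :* y) refl v τ ε z y ⟩
      v * y + τ * z + ε * y     ∎

    -- The mirror image: raising `y` to `z` gains `(v - τ) * (z - y)`, which is at most
    -- `ε * (z - y)`, hence at most `ε * z`.
    increase-priced : v ≤ τ + ε → y ≤ z → 0# ≤ y → v * z + τ * y ≤ v * y + τ * z + ε * z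
    increase-priced {y} {z} v≤τ+ε y≤z 0≤y = begin
      v * z + τ * y             ≤⟨ x≤x+y (*-nonNegative 0≤ε 0≤y) ⟩
      v * z + τ * y + ε * y
        ≈⟨ solve 5 (λ v τ e z y → v :* z :+ τ :* y :+ e :* y := v :* z :+ (τ :+ e) :* y) refl v τ ε z y ⟩
      v * z + (τ + ε) * y       ≤⟨ rearrangement v≤τ+ε y≤z ⟩
      v * y + (τ + ε) * z
        ≈⟨ solve 5 (λ v τ e z y → v :* y :+ (τ :+ e) :* z := v :* y :+ τ :* z :+ e :* z) refl v τ ε z y ⟩
      v * y + τ * z + ε * z     ∎

-- Weak duality and interpolation for the knapsack problem

module KnapsackProperties {c ℓ₁ ℓ₂ a ℓ} (K : OrderedField c ℓ₁ ℓ₂) (I : Instance K a ℓ) where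
  open OrderedField K
  open Instance I
  open OrderedFieldProperties K
  open Solver commutativeSemiring using (solve; _:=_; _:+_; _:*_)
  open ≤-Reasoning

  0≤vᵢ : ∀ i → 0# ≤ vᵢ i
  0≤vᵢ i = proj₁ (0<v (attr i))

  0<w : ∀ x → 0# < w x
  0<w x = 0≤w , λ 0≈w → proj₂ 0<w-min (antisym (proj₁ 0<w-min) (begin
    w-min ≤⟨ w-min≤w x ⟩
    w x   ≈⟨ 0≈w ⟨
    0#    ∎))
    where
    0≤w : 0# ≤ w x
    0≤w = ≤-trans (proj₁ 0<w-min) (w-min≤w x)

  0≤wᵢ : ∀ i → 0# ≤ wᵢ i
  0≤wᵢ i = proj₁ (0<w (attr i))

  0≤ρᵢ : ∀ i → 0# ≤ ρᵢ i
  0≤ρᵢ i = *-nonNegative (0≤vᵢ i) (0≤x⁻¹ (0<w (attr i)))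

  ρᵢ≤⇒vᵢ≤ : ∀ {i x} → ρᵢ i ≤ x → vᵢ i ≤ x * wᵢ i
  ρᵢ≤⇒vᵢ≤ {i} {x} ρ≤x = begin
    vᵢ i        ≈⟨ ÷-*-cancel (0<w (attr i)) ⟨
    ρᵢ i * wᵢ i ≤⟨ *-monoʳ-≤ (0≤wᵢ i) ρ≤x ⟩
    x * wᵢ i    ∎

  ≤ρᵢ⇒≤vᵢ : ∀ {i x} → x ≤ ρᵢ i → x * wᵢ i ≤ vᵢ i
  ≤ρᵢ⇒≤vᵢ {i} {x} x≤ρ = begin
    x * wᵢ i    ≤⟨ *-monoʳ-≤ (0≤wᵢ i) x≤ρ ⟩
    ρᵢ i * wᵢ i ≈⟨ ÷-*-cancel (0<w (attr i)) ⟩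
    vᵢ i        ∎

  ∑-weight : ∀ S τ x → ∑ (_∈? S) (λ i → τ * wᵢ i * x i) ≈ τ * weight S x
  ∑-weight S τ x = trans (∑-cong (_∈? S) λ _ → *-assoc _ _ _) (∑-*ˡ (_∈? S) τ _)

  -- Weak duality: τ is the price of a unit of weight and e i the error made
  -- by pricing item i at τ.
  exchange : ∀ {S τ z y} {e : Fin n → Carrier} → 0# ≤ τ → weight S z ≤ weight S y →
             (∀ {i} → i ∈ S → vᵢ i * z i + τ * wᵢ i * y i ≤ vᵢ i * y i + τ * wᵢ i * z i + e i) →
             value S z ≤ value S y + ∑ (_∈? S) e
  exchange {S} {τ} {z} {y} {e} 0≤τ Wz≤Wy priced = +-cancelʳ-≤ (τ * weight S y) (begin
    value S z + τ * weight S y                    ≈⟨ +-congˡ (∑-weight S τ y) ⟨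
    value S z + ∑S (λ i → τ * wᵢ i * y i)         ≈⟨ ∑-+ (_∈? S) _ _ ⟨
    ∑S (λ i → vᵢ i * z i + τ * wᵢ i * y i)        ≤⟨ ∑-mono-≤ (_∈? S) priced ⟩
    ∑S (λ i → vᵢ i * y i + τ * wᵢ i * z i + e i)  ≈⟨ ∑-+ (_∈? S) _ _ ⟩
    ∑S (λ i → vᵢ i * y i + τ * wᵢ i * z i) + ∑S e ≈⟨ +-congʳ (∑-+ (_∈? S) _ _) ⟩
    value S y + ∑S (λ i → τ * wᵢ i * z i) + ∑S e  ≈⟨ +-congʳ (+-congˡ (∑-weight S τ z)) ⟩
    value S y + τ * weight S z + ∑S e
      ≤⟨ +-mono-≤ (+-mono-≤ ≤-refl (*-monoˡ-≤ 0≤τ Wz≤Wy)) ≤-refl ⟩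
    value S y + τ * weight S y + ∑S e
      ≈⟨ solve 3 (λ v t e → v :+ t :+ e := v :+ e :+ t) refl (value S y) (τ * weight S y) (∑S e) ⟩
    value S y + ∑S e + τ * weight S y ∎)
    where
    ∑S : (Fin n → Carrier) → Carrier
    ∑S = ∑ (_∈? S)

  weight-mono-≤ : ∀ {S x y} → (∀ i → x i ≤ y i) → weight S x ≤ weight S y
  weight-mono-≤ {S} x≤y = ∑-mono-≤ (_∈? S) λ {i} _ → *-monoˡ-≤ (0≤wᵢ i) (x≤y i)

  -- Weight is linear, so the coefficients that express `C` through the weights of `lo` and `hi`
  -- also serve for the allocations, the same for every item. This gives the intermediate value over
  -- any ordered field.
  interpolate : ∀ {S lo hi C} → (∀ i → lo i ≤ hi i) → weight S lo ≤ C → C ≤ weight S hi →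
    ∃ λ p → (∀ i → lo i ≤ p i) × (∀ i → p i ≤ hi i) × weight S p ≈ C
  interpolate {S} {lo} {hi} {C} lo≤hi Wlo≤C C≤Whi
    with ∃-convexCombination Wlo≤C C≤Whi
  ... | σ , θ , 0≤σ , 0≤θ , σ+θ≈1 , ≈C =
    (λ i → σ * lo i + θ * hi i) ,
    (λ i → lower≤convex σ+θ≈1 (lo≤hi i) 0≤θ) ,
    (λ i → convex≤upper σ+θ≈1 (lo≤hi i) 0≤σ) ,
    (begin-equality
      ∑S (λ i → wᵢ i * (σ * lo i + θ * hi i))
        ≈⟨ ∑-cong (_∈? S) (λ {i} _ → solve 5 (λ w s l t h → w :* (s :* l :+ t :* h)
             := s :* (w :* l) :+ t :* (w :* h)) refl (wᵢ i) σ (lo i) θ (hi i)) ⟩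
      ∑S (λ i → σ * (wᵢ i * lo i) + θ * (wᵢ i * hi i))
        ≈⟨ ∑-+ (_∈? S) _ _ ⟩
      ∑S (λ i → σ * (wᵢ i * lo i)) + ∑S (λ i → θ * (wᵢ i * hi i))
        ≈⟨ +-cong (∑-*ˡ (_∈? S) σ _) (∑-*ˡ (_∈? S) θ _) ⟩
      σ * weight S lo + θ * weight S hi
        ≈⟨ ≈C ⟩
      C ∎)
    where
    ∑S : (Fin n → Carrier) → Carrier
    ∑S = ∑ (_∈? S)

-- Inversions of ratios between groups

module GroupingProperties {c ℓ₁ ℓ₂ a ℓ} (K : OrderedField c ℓ₁ ℓ₂) (I : Instance K a ℓ)
                          {δ} (𝒢 : MetricGrouping K I δ) where
  open OrderedField K
  open Instance I
  open MetricGrouping 𝒢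
  open OrderedFieldProperties K
  open KnapsackProperties K I
  open Solver commutativeSemiring using (solve; _:=_; _:+_; _:*_)
  open ≤-Reasoning

  ∈⇒groupOf≡ : ∀ {i k} → i ∈ G k → groupOf i ≡ k
  ∈⇒groupOf≡ {i} i∈Gk = disjoint (proj₂ (cover i)) i∈Gk

  ∈groupOf : ∀ i → i ∈ G (groupOf i)
  ∈groupOf i = proj₂ (cover i)

  private
    gap : Fin m × Fin m → Carrier
    gap (k , k′) = (maxOn k′ ρᵢ - minOn k ρᵢ) ⁺

  0≤ω : 0# ≤ ω
  0≤ω = Extrema.⊥≤max totalOrder 0# (map gap increasingPairs)

  max-min≤ω : ∀ {k k′} → k Fin.< k′ → maxOn k′ ρᵢ - minOn k ρᵢ ≤ ω
  max-min≤ω {k} {k′} k<k′ = ≤-trans (NaturalMax.x≤x⊔y totalOrder _ 0#)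
    (lookup (Extrema.xs≤max totalOrder 0# (map gap increasingPairs))
      (∈-map⁺ gap (∈-filter⁺ (λ p → proj₁ p <? proj₂ p)
        (∈-cartesianProduct⁺ (∈-allFin k) (∈-allFin k′)) k<k′)))

  -- The inversion between two items is no larger than the one between the extreme ratios of their
  -- groups, which is among the quantities maximised in `ω`.
  ρᵢ≤ρᵢ+ω : ∀ {i l} → groupOf i Fin.< groupOf l → ρᵢ l ≤ ρᵢ i + ω
  ρᵢ≤ρᵢ+ω {i} {l} i<l = begin
    ρᵢ l                   ≤⟨ ≤maxOver (nonempty (groupOf l)) ρᵢ (∈groupOf l) ⟩
    maxOn (groupOf l) ρᵢ   ≤⟨ x-y≤z⇒x≤y+z (max-min≤ω i<l) ⟩
    minOn (groupOf i) ρᵢ + ω ≤⟨ +-mono-≤ (minOver≤ (nonempty (groupOf i)) ρᵢ (∈groupOf i)) ≤-refl ⟩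
    ρᵢ i + ω               ∎

  orderCompatible : ω ≈ 0# → OrderCompatible
  orderCompatible ω≈0 {k} {k′} k<k′ = begin
    maxOn k′ ρᵢ    ≤⟨ x-y≤z⇒x≤y+z (max-min≤ω k<k′) ⟩
    minOn k ρᵢ + ω ≈⟨ +-congˡ ω≈0 ⟩
    minOn k ρᵢ + 0# ≈⟨ +-identityʳ _ ⟩
    minOn k ρᵢ     ∎

  ∣vᵢ-v̂∣≤ε : ∀ {i k} → i ∈ G k → ∣ vᵢ i - v̂ k ∣ ≤ ε-v
  ∣vᵢ-v̂∣≤ε {i} {k} i∈G = ≤-trans (Lipschitz.bound v-lipschitz (attr i) (rep k))
    (*-monoˡ-≤ (Lipschitz.0≤L v-lipschitz) (close i∈G))

  -- Losses within one group and from filling the groups in order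

  module _ (k : Fin m) where
    private
      W = w⁺ k + w⁻ k
      g = w⁺ k - w⁻ k

    -- The price 2 v̂ / (w⁺ + w⁻) equalises the relative pricing errors at
    -- the two extreme weights.
    price spread : Carrier
    price  = (v̂ k + v̂ k) ÷ W
    spread = v̂ k * (g ÷ W) + ε-v

    w⁻≤wᵢ : ∀ {i} → i ∈ G k → w⁻ k ≤ wᵢ i
    w⁻≤wᵢ = minOver≤ (nonempty k) wᵢ

    wᵢ≤w⁺ : ∀ {i} → i ∈ G k → wᵢ i ≤ w⁺ k
    wᵢ≤w⁺ = ≤maxOver (nonempty k) wᵢ

    private
      -- `w⁺ k` dominates the positive weight of some item of the group, so dividing by `W` is
      -- legitimate.
      0<W : 0# < W
      0<W = ≤-trans 0≤w⁺ (x≤x+y 0≤w⁻) , λ 0≈W → proj₂ (0<w (attr i₀)) (antisym 0≤wᵢ₀ (begin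
        wᵢ i₀ ≤⟨ wᵢ≤w⁺ i₀∈G ⟩
        w⁺ k  ≤⟨ x≤x+y 0≤w⁻ ⟩
        W     ≈⟨ 0≈W ⟨
        0#    ∎))
        where
        i₀ = proj₁ (nonempty k)
        i₀∈G = proj₂ (nonempty k)
        0≤wᵢ₀ = 0≤wᵢ i₀
        0≤w⁻ : 0# ≤ w⁻ k
        0≤w⁻ = ≤minOver (nonempty k) wᵢ 0≤wᵢ
        0≤w⁺ : 0# ≤ w⁺ k
        0≤w⁺ = ≤-trans 0≤wᵢ₀ (wᵢ≤w⁺ i₀∈G)

      0≤v̂ : 0# ≤ v̂ k
      0≤v̂ = proj₁ (0<v (rep k))

      0≤ε : 0# ≤ ε-v
      0≤ε = *-nonNegative (Lipschitz.0≤L v-lipschitz) (proj₁ 0<δ)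

      v̂≈v̂*W÷W : v̂ k ≈ v̂ k * W * W ⁻¹
      v̂≈v̂*W÷W = begin-equality
        v̂ k            ≈⟨ *-identityʳ _ ⟨
        v̂ k * 1#       ≈⟨ *-congˡ (0<x⇒x*x⁻¹≈1 0<W) ⟨
        v̂ k * (W ÷ W)  ≈⟨ *-assoc _ _ _ ⟨
        v̂ k * W * W ⁻¹ ∎

      -- Replacing `w⁺ k` by `w⁻ k + g` makes the identities below free of subtraction, within reach
      -- of the semiring solver.
      w⁺≈ : w⁺ k ≈ w⁻ k + g
      w⁺≈ = y≈x+[y-x] (w⁻ k) (w⁺ k)

    0≤price : 0# ≤ price
    0≤price = *-nonNegative (≤-trans 0≤v̂ (x≤x+y 0≤v̂)) (0≤x⁻¹ 0<W)

    0≤spread : 0# ≤ spread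
    0≤spread = ≤-trans (*-nonNegative 0≤v̂ (*-nonNegative
      (0≤y-x (≤-trans (w⁻≤wᵢ (proj₂ (nonempty k))) (wᵢ≤w⁺ (proj₂ (nonempty k))))) (0≤x⁻¹ 0<W)))
      (x≤x+y 0≤ε)

    -- The worst case is the smallest weight, where the price falls short of `v̂ k` by exactly
    -- `v̂ k * (g ÷ W)`; the Lipschitz error `ε-v` supplies the rest of `spread`.
    vᵢ≤price+spread : ∀ {i} → i ∈ G k → vᵢ i ≤ price * wᵢ i + spread
    vᵢ≤price+spread {i} i∈G = begin
      vᵢ i                                ≤⟨ ∣x-y∣≤z⇒x≤y+z (∣vᵢ-v̂∣≤ε i∈G) ⟩
      v̂ k + ε-v                           ≈⟨ +-congʳ v̂≈v̂*W÷W ⟩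
      v̂ k * W * W ⁻¹ + ε-v                ≈⟨ +-congʳ (*-congʳ (*-congˡ (+-congʳ w⁺≈))) ⟩
      v̂ k * (w⁻ k + g + w⁻ k) * W ⁻¹ + ε-v
        ≈⟨ solve 5 (λ v w g j e → v :* (w :+ g :+ w) :* j :+ e
                               := (v :+ v) :* j :* w :+ (v :* (g :* j) :+ e)) refl (v̂ k) (w⁻ k) g (W ⁻¹) ε-v ⟩
      price * w⁻ k + spread               ≤⟨ +-mono-≤ (*-monoˡ-≤ 0≤price (w⁻≤wᵢ i∈G)) ≤-refl ⟩
      price * wᵢ i + spread               ∎

    -- The worst case is now the largest weight, where the price exceeds `v̂ k` by the same amount
    -- `v̂ k * (g ÷ W)`.
    price≤vᵢ+spread : ∀ {i} → i ∈ G k → price * wᵢ i ≤ vᵢ i + spread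
    price≤vᵢ+spread {i} i∈G = begin
      price * wᵢ i            ≤⟨ *-monoˡ-≤ 0≤price (wᵢ≤w⁺ i∈G) ⟩
      price * w⁺ k            ≈⟨ *-congˡ w⁺≈ ⟩
      price * (w⁻ k + g)
        ≈⟨ solve 4 (λ v w g j → (v :+ v) :* j :* (w :+ g)
             := v :* (w :+ g :+ w) :* j :+ v :* (g :* j)) refl (v̂ k) (w⁻ k) g (W ⁻¹) ⟩
      v̂ k * (w⁻ k + g + w⁻ k) * W ⁻¹ + v̂ k * (g ÷ W)
        ≈⟨ +-congʳ (trans v̂≈v̂*W÷W (*-congʳ (*-congˡ (+-congʳ w⁺≈)))) ⟨
      v̂ k + v̂ k * (g ÷ W)     ≤⟨ +-mono-≤ (∣x-y∣≤z⇒y≤x+z (∣vᵢ-v̂∣≤ε i∈G)) ≤-refl ⟩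
      vᵢ i + ε-v + v̂ k * (g ÷ W)
        ≈⟨ solve 3 (λ v e x → v :+ e :+ x := v :+ (x :+ e)) refl (vᵢ i) ε-v (v̂ k * (g ÷ W)) ⟩
      vᵢ i + spread           ∎

    -- At `price`, a unit of any item of the group is mispriced by at most `spread` in either
    -- direction. Both allocations stay below `u i`, so item `i` contributes at most `spread * u i`
    -- to the error in `exchange`.
    intraGroupLoss≤ : ∀ {z x : Fin n → Carrier} → (∀ {i} → i ∈ G k → 0# ≤ z i × z i ≤ u i) →
      (∀ {i} → i ∈ G k → 0# ≤ x i × x i ≤ u i) → weight (G k) z ≤ weight (G k) x →
      value (G k) z ≤ value (G k) x + U (G k) * spread
    intraGroupLoss≤ {z} {x} z-bounds x-bounds Wz≤Wx = begin
      value (G k) z ≤⟨ exchange {e = λ i → spread * u i} 0≤price Wz≤Wx priced ⟩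
      value (G k) x + ∑ (_∈? G k) (λ i → spread * u i) ≈⟨ +-congˡ (∑-*ˡ (_∈? G k) spread u) ⟩
      value (G k) x + spread * U (G k) ≈⟨ +-congˡ (*-comm _ _) ⟩
      value (G k) x + U (G k) * spread ∎
      where
      priced : ∀ {i} → i ∈ G k →
        vᵢ i * z i + price * wᵢ i * x i ≤ vᵢ i * x i + price * wᵢ i * z i + spread * u i
      priced {i} i∈G with total (z i) (x i)
      ... | inj₁ z≤x = ≤-trans
        (decrease-priced 0≤spread (price≤vᵢ+spread i∈G) z≤x (proj₁ (z-bounds i∈G)))
        (+-mono-≤ ≤-refl (*-monoˡ-≤ 0≤spread (proj₂ (x-bounds i∈G))))
      ... | inj₂ x≤z = ≤-trans
        (increase-priced 0≤spread (vᵢ≤price+spread i∈G) x≤z (proj₁ (x-bounds i∈G)))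
        (+-mono-≤ ≤-refl (*-monoˡ-≤ 0≤spread (proj₂ (z-bounds i∈G))))

    -- The shape of `zᵍᵖ` with an arbitrary `p` on group `k`. It covers the grouped allocation,
    -- where `p` is water filling, as well as the allocation with which the optimum is compared.
    fill : (Fin n → Carrier) → Fin n → Carrier
    fill p i with <-cmp (groupOf i) k
    ... | tri< _ _ _ = u i
    ... | tri≈ _ _ _ = p i
    ... | tri> _ _ _ = 0#

    -- The coefficients `h` are left general because the decomposition serves both weights and
    -- values.
    ∑-fill : ∀ (h p : Fin n → Carrier) → ∑ (_∈? ⊤ {n}) (λ i → h i * fill p i) ≈
             ∑ (_<? k) (λ j → ∑ (_∈? G j) (λ i → h i * u i)) + ∑ (_∈? G k) (λ i → h i * p i)
    ∑-fill h p = begin-equality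
      ∑ (_∈? ⊤ {n}) (λ i → h i * fill p i)
        ≈⟨ ∑-cong (_∈? ⊤ {n}) (λ {i} _ → split i) ⟩
      ∑ (_∈? ⊤ {n}) (λ i → low i + mid i)
        ≈⟨ ∑-+ (_∈? ⊤ {n}) low mid ⟩
      ∑ (_∈? ⊤ {n}) low + ∑ (_∈? ⊤ {n}) mid
        ≈⟨ +-cong (∑-⊤ low) (∑-⊤ mid) ⟩
      ∑ (λ i → groupOf i <? k) (λ i → h i * u i) + ∑ (_∈? G k) (λ i → h i * p i)
        ≈⟨ +-congʳ (∑-fibres (_<? k) G groupOf ∈groupOf (≡.sym ∘ ∈⇒groupOf≡) _) ⟨
      ∑ (_<? k) (λ j → ∑ (_∈? G j) (λ i → h i * u i)) + ∑ (_∈? G k) (λ i → h i * p i) ∎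
      where
      low mid : Fin n → Carrier
      low i = if does (groupOf i <? k) then h i * u i else 0#
      mid i = if does (i ∈? G k) then h i * p i else 0#
      split : ∀ i → h i * fill p i ≈ low i + mid i
      split i with <-cmp (groupOf i) k
      ... | tri< i<k i≢k _ = begin-equality
        h i * u i      ≈⟨ +-identityʳ _ ⟨
        h i * u i + 0# ≈⟨ +-cong (if-yes (groupOf i <? k) i<k) (if-no (i ∈? G k) (i≢k ∘ ∈⇒groupOf≡)) ⟨
        low i + mid i  ∎
      ... | tri≈ i≮k i≡k _ = begin-equality
        h i * p i      ≈⟨ +-identityˡ _ ⟨
        0# + h i * p i ≈⟨ +-cong (if-no (groupOf i <? k) i≮k)
          (if-yes (i ∈? G k) (≡.subst (λ j → i ∈ G j) i≡k (∈groupOf i))) ⟨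
        low i + mid i  ∎
      ... | tri> i≮k i≢k _ = begin-equality
        h i * 0#       ≈⟨ zeroʳ (h i) ⟩
        0#             ≈⟨ +-identityʳ 0# ⟨
        0# + 0#        ≈⟨ +-cong (if-no (groupOf i <? k) i≮k) (if-no (i ∈? G k) (i≢k ∘ ∈⇒groupOf≡)) ⟨
        low i + mid i  ∎

    fill-elim : ∀ {q} (Q : Fin n → Carrier → Set q) {p} →
      (∀ {i} → groupOf i Fin.< k → Q i (u i)) → (∀ {i} → groupOf i ≡ k → Q i (p i)) →
      (∀ {i} → k Fin.< groupOf i → Q i 0#) → ∀ i → Q i (fill p i)
    fill-elim Q below at above i with <-cmp (groupOf i) k
    ... | tri< i<k _ _ = below i<k
    ... | tri≈ _ i≡k _ = at i≡k
    ... | tri> _ _ k<i = above k<i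

    weight-fill : ∀ {p C} → weight (G k) p ≈ C - F< k → weight ⊤ (fill p) ≈ C
    weight-fill {p} {C} Wp≈c⋆ = begin-equality
      weight ⊤ (fill p)       ≈⟨ ∑-fill wᵢ p ⟩
      F< k + weight (G k) p   ≈⟨ +-congˡ Wp≈c⋆ ⟩
      F< k + (C - F< k)       ≈⟨ y≈x+[y-x] (F< k) C ⟨
      C                       ∎

    private
      -- If item `i` is mispriced by `ω` per unit of weight on an amount `x i`, the errors add up to
      -- `ω` times the weight of `x`. Below, `x` is `z` itself or the filled allocation; both
      -- respect the budget.
      exchange-ω : ∀ {C τ} {y z x : Fin n → Carrier} → 0# ≤ τ →
        weight ⊤ z ≤ C → weight ⊤ y ≈ C → weight ⊤ x ≤ C →
        (∀ i → vᵢ i * z i + τ * wᵢ i * y i ≤ vᵢ i * y i + τ * wᵢ i * z i + ω * wᵢ i * x i) →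
        value ⊤ z ≤ value ⊤ y + ω * C
      exchange-ω {C} {τ} {y} {z} {x} 0≤τ Wz≤C Wy≈C Wx≤C priced = begin
        value ⊤ z
          ≤⟨ exchange 0≤τ (≤-trans Wz≤C (≤-reflexive (sym Wy≈C))) (λ {i} _ → priced i) ⟩
        value ⊤ y + ∑ (_∈? ⊤ {n}) (λ i → ω * wᵢ i * x i)
          ≈⟨ +-congˡ (∑-weight ⊤ ω x) ⟩
        value ⊤ y + ω * weight ⊤ x
          ≤⟨ +-mono-≤ ≤-refl (*-monoˡ-≤ 0≤ω Wx≤C) ⟩
        value ⊤ y + ω * C ∎

      0≤ω*w : ∀ i → 0# ≤ ω * wᵢ i
      0≤ω*w i = *-nonNegative 0≤ω (0≤wᵢ i)

      errorless : ∀ {l r x y} → l ≤ r + 0# * x → 0# ≤ y → l ≤ r + y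
      errorless {l} {r} {x} {y} l≤r 0≤y = begin
        l          ≤⟨ l≤r ⟩
        r + 0# * x ≤⟨ +-mono-≤ ≤-refl (≤-trans (≤-reflexive (zeroˡ x)) 0≤y) ⟩
        r + y      ∎

      i₀ : Fin n
      i₀ = proj₁ (nonempty k)

      i₀≡k : Fin.toℕ (groupOf i₀) ≡ Fin.toℕ k
      i₀≡k = ≡.cong Fin.toℕ (∈⇒groupOf≡ (proj₂ (nonempty k)))

    -- The price is the smallest ratio up to group `k`. On these groups the filled allocation is at
    -- least `z` and every ratio is at least the price, so no error arises. A later item has ratio
    -- at most the price plus `ω` and is lowered from `z i` to zero, so the total error is at most
    -- `ω` times the weight of `z`.
    fill-loss-≥ : ∀ {C z p} → (∀ i → 0# ≤ z i) → (∀ i → z i ≤ u i) → weight ⊤ z ≤ C →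
      weight (G k) p ≈ C - F< k → (∀ i → z i ≤ p i) → value ⊤ z ≤ value ⊤ (fill p) + ω * C
    fill-loss-≥ {C} {z} {p} 0≤z z≤u Wz≤C Wp≈c⋆ z≤p =
      exchange-ω (0≤ρᵢ l) Wz≤C (weight-fill Wp≈c⋆) Wz≤C
        (fill-elim Priced
          (λ {i} i<k → no-gain (ℕ.<⇒≤ i<k) (z≤u i))
          (λ {i} i≡k → no-gain (ℕ.≤-reflexive (≡.cong Fin.toℕ i≡k)) (z≤p i))
          (λ {i} k<i → increase-priced (0≤ω*w i)
            (≤-trans (ρᵢ≤⇒vᵢ≤ (ρᵢ≤ρᵢ+ω (ℕ.≤-<-trans l≤k k<i))) (≤-reflexive (distribʳ _ _ _)))
            (0≤z i) ≤-refl))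
      where
      -- The minimiser `l` lies in group `k` or an earlier one, which is what lets `ρᵢ≤ρᵢ+ω` compare
      -- it with all later items. The item `i₀` of group `k` shows that there is a candidate.
      cheapest = ∃-minimiser (λ i → groupOf i ≤? k) ρᵢ (i₀ , ℕ.≤-reflexive i₀≡k)
      l     = proj₁ cheapest
      l≤k   = proj₁ (proj₂ cheapest)
      ρ-min = proj₂ (proj₂ cheapest)
      Priced : Fin n → Carrier → Set _
      Priced i y = vᵢ i * z i + ρᵢ l * wᵢ i * y ≤ vᵢ i * y + ρᵢ l * wᵢ i * z i + ω * wᵢ i * z i
      no-gain : ∀ {i y} → groupOf i Fin.≤ k → z i ≤ y → Priced i y
      no-gain {i} i≤k z≤y = errorless
        (decrease-priced ≤-refl (≤-trans (≤ρᵢ⇒≤vᵢ (ρ-min i≤k)) (x≤x+y ≤-refl)) z≤y (0≤z i))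
        (*-nonNegative (0≤ω*w i) (0≤z i))

    -- Dually, the price is the largest ratio from group `k` on. There the filled allocation is at
    -- most `z` and no ratio exceeds the price, so no error arises. The price exceeds the ratio of
    -- an earlier item by at most `ω`, so the total error is at most `ω` times the weight of the
    -- filled allocation, which is `C`.
    fill-loss-≤ : ∀ {C z p} → (∀ i → 0# ≤ z i) → (∀ i → z i ≤ u i) → weight ⊤ z ≤ C →
      weight (G k) p ≈ C - F< k → (∀ i → 0# ≤ p i) → (∀ i → p i ≤ z i) →
      value ⊤ z ≤ value ⊤ (fill p) + ω * C
    fill-loss-≤ {C} {z} {p} 0≤z z≤u Wz≤C Wp≈c⋆ 0≤p p≤z =
      exchange-ω (0≤ρᵢ l) Wz≤C (weight-fill Wp≈c⋆) (≤-reflexive (weight-fill Wp≈c⋆))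
        (fill-elim Priced
          (λ {i} i<k → decrease-priced (0≤ω*w i) (overpriced i<k) (z≤u i) (0≤z i))
          (λ {i} i≡k → no-gain (ℕ.≤-reflexive (≡.cong Fin.toℕ (≡.sym i≡k))) (0≤p i) (p≤z i))
          (λ {i} k<i → no-gain (ℕ.<⇒≤ k<i) ≤-refl (0≤z i)))
      where
      dearest = ∃-maximiser (λ i → k ≤? groupOf i) ρᵢ (i₀ , ℕ.≤-reflexive (≡.sym i₀≡k))
      l     = proj₁ dearest
      k≤l   = proj₁ (proj₂ dearest)
      ρ-max = proj₂ (proj₂ dearest)
      Priced : Fin n → Carrier → Set _
      Priced i y = vᵢ i * z i + ρᵢ l * wᵢ i * y ≤ vᵢ i * y + ρᵢ l * wᵢ i * z i + ω * wᵢ i * y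
      no-gain : ∀ {i y} → k Fin.≤ groupOf i → 0# ≤ y → y ≤ z i → Priced i y
      no-gain {i} k≤i 0≤y y≤z = errorless
        (increase-priced ≤-refl (≤-trans (ρᵢ≤⇒vᵢ≤ (ρ-max k≤i)) (x≤x+y ≤-refl)) y≤z 0≤y)
        (*-nonNegative (0≤ω*w i) 0≤y)
      overpriced : ∀ {i} → groupOf i Fin.< k → ρᵢ l * wᵢ i ≤ vᵢ i + ω * wᵢ i
      overpriced {i} i<k = begin
        ρᵢ l * wᵢ i            ≤⟨ *-monoʳ-≤ (0≤wᵢ i) (ρᵢ≤ρᵢ+ω (ℕ.<-≤-trans i<k k≤l)) ⟩
        (ρᵢ i + ω) * wᵢ i      ≈⟨ distribʳ _ _ _ ⟩
        ρᵢ i * wᵢ i + ω * wᵢ i ≤⟨ +-mono-≤ (≤ρᵢ⇒≤vᵢ ≤-refl) ≤-refl ⟩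
        vᵢ i + ω * wᵢ i        ∎

    -- On group k, p is interpolated above z if z underuses the group and below
    -- z otherwise, so that the sign of z − p is known throughout the group.
    fill-loss : ∀ {C z} → (∀ i → 0# ≤ z i) → (∀ i → z i ≤ u i) → weight ⊤ z ≤ C →
      0# ≤ C - F< k → C - F< k ≤ F (G k) →
      ∃ λ p → (∀ i → 0# ≤ p i) × (∀ i → p i ≤ u i) × weight (G k) p ≈ C - F< k ×
              value ⊤ z ≤ value ⊤ (fill p) + ω * C
    fill-loss {C} {z} 0≤z z≤u Wz≤C 0≤c⋆ c⋆≤F =
      [ underused , overused ]′ (total (weight (G k) z) (C - F< k))
      where
      Bounded : (Fin n → Carrier) → Set _
      Bounded p = (∀ i → 0# ≤ p i) × (∀ i → p i ≤ u i) × weight (G k) p ≈ C - F< k ×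
                  value ⊤ z ≤ value ⊤ (fill p) + ω * C
      underused : weight (G k) z ≤ C - F< k → ∃ Bounded
      underused W≤c⋆ =
        let p , z≤p , p≤u , Wp≈c⋆ = interpolate {S = G k} z≤u W≤c⋆ c⋆≤F
        in p , (λ i → ≤-trans (0≤z i) (z≤p i)) , p≤u , Wp≈c⋆ ,
           fill-loss-≥ 0≤z z≤u Wz≤C Wp≈c⋆ z≤p
      W0≈0 : weight (G k) (const 0#) ≈ 0#
      W0≈0 = trans (∑-cong (_∈? G k) λ _ → *-comm _ _) (trans (∑-*ˡ (_∈? G k) 0# wᵢ) (zeroˡ _))
      overused : C - F< k ≤ weight (G k) z → ∃ Bounded
      overused c⋆≤W =
        let p , 0≤p , p≤z , Wp≈c⋆ = interpolate {S = G k} 0≤z (≤-trans (≤-reflexive W0≈0) 0≤c⋆) c⋆≤W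
        in p , 0≤p , (λ i → ≤-trans (p≤z i) (z≤u i)) , Wp≈c⋆ ,
           fill-loss-≤ 0≤z z≤u Wz≤C Wp≈c⋆ 0≤p p≤z

-- Bounds for the grouped allocation

proposition13 : ∀ {c ℓ₁ ℓ₂ a ℓ} (K : OrderedField c ℓ₁ ℓ₂) (I : Instance K a ℓ) →
    let open OrderedField K
        open Instance I
    in
    (δ : Carrier) (𝒢 : MetricGrouping K I δ) →
    let open MetricGrouping 𝒢 in
    (C : Carrier) → 0# ≤ C → C < F ⊤ →
    (𝒶 : GroupedAllocation C) →
    let open GroupedAllocation 𝒶 in
    (V⋆ : Carrier) → IsKnapsackMax ⊤ C V⋆ →
    (VΓ : Carrier) → IsKnapsackMax Γ c⋆ VΓ →
    (E V⋆ ≤ ΔΓ VΓ + ω * C) ×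
    (ΔΓ VΓ ≤ ΔΓ-bound) ×
    (ω ≈ 0# → OrderCompatible × (E V⋆ ≤ ΔΓ VΓ) × (ΔΓ VΓ ≤ ΔΓ-bound))
proposition13 K I δ 𝒢 C _ _ 𝒶 V⋆ V⋆-max VΓ VΓ-max =
  E≤ , ΔΓ≤ , λ ω≈0 → orderCompatible ω≈0 , E≤ΔΓ ω≈0 , ΔΓ≤
  where
  open OrderedField K
  open Instance I
  open MetricGrouping 𝒢
  open GroupedAllocation 𝒶
  open OrderedFieldProperties K
  open KnapsackProperties K I
  open GroupingProperties K I 𝒢
  open IsWaterLevel isWaterLevel
  open Feasible
  open Solver commutativeSemiring using (solve; _:=_; _:+_)
  open ≤-Reasoning

  wf : Fin n → Carrier
  wf = waterFilling ζ

  0≤wf : ∀ i → 0# ≤ wf i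
  0≤wf i = NaturalMin.⊓-glb totalOrder (0≤u i) 0≤ζ

  wf≤u : ∀ i → wf i ≤ u i
  wf≤u i = NaturalMin.x⊓y≤x totalOrder (u i) ζ

  -- The two functions make the same case distinction in separate `with` clauses, so they agree only
  -- once it has been repeated here.
  zᵍᵖ≡fill : ∀ i → zᵍᵖ i ≡ fill k⋆ wf i
  zᵍᵖ≡fill i with <-cmp (groupOf i) k⋆
  ... | tri< _ _ _ = ≡.refl
  ... | tri≈ _ _ _ = ≡.refl
  ... | tri> _ _ _ = ≡.refl

  below : Carrier
  below = ∑ (_<? k⋆) (λ j → value (G j) u)

  Vᵍᵖ≈ : Vᵍᵖ ≈ below + value Γ wf
  Vᵍᵖ≈ = trans (∑-cong (_∈? ⊤ {n}) λ {i} _ → *-congˡ (reflexive (zᵍᵖ≡fill i))) (∑-fill k⋆ vᵢ wf)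

  -- Both bounds on `c⋆`, this one and `c⋆≤F`, are read off the water level: `c⋆` is the weight of
  -- an allocation lying between zero and `u`.
  0≤c⋆ : 0# ≤ c⋆
  0≤c⋆ = begin
    0#                              ≈⟨ zeroˡ _ ⟨
    0# * ∑ (_∈? Γ) wᵢ               ≈⟨ ∑-*ˡ (_∈? Γ) 0# wᵢ ⟨
    ∑ (_∈? Γ) (λ i → 0# * wᵢ i)     ≤⟨ ∑-mono-≤ (_∈? Γ) (λ {i} _ →
      ≤-trans (≤-reflexive (zeroˡ _)) (*-nonNegative (0≤wᵢ i) (0≤wf i))) ⟩
    weight Γ wf                     ≈⟨ level ⟩
    c⋆                              ∎

  c⋆≤F : c⋆ ≤ F Γ
  c⋆≤F = ≤-trans (≤-reflexive (sym level)) (weight-mono-≤ wf≤u)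

  -- The optimum is first compared with `fill k⋆ p`, at a cost of `ω * C`. This allocation and `zᵍᵖ`
  -- agree outside the boundary group, and there replacing `p` by water filling costs at most
  -- `ΔΓ VΓ`.
  E≤ : E V⋆ ≤ ΔΓ VΓ + ω * C
  E≤ =
    let z , z-feasible , Vz≈V⋆ = IsKnapsackMax.attained V⋆-max
        p , 0≤p , p≤u , Wp≈c⋆ , Vz≤ = fill-loss k⋆
          (λ i → 0≤z z-feasible ∈⊤) (λ i → z≤u z-feasible ∈⊤) (budget z-feasible) 0≤c⋆ c⋆≤F
        -- Since `p` uses exactly `c⋆` on the boundary group, it competes in the knapsack problem
        -- whose optimum is `VΓ`.
        Vp≤VΓ = IsKnapsackMax.upperBound VΓ-max p record
          { 0≤z = λ {i} _ → 0≤p i ; z≤u = λ {i} _ → p≤u i ; budget = ≤-reflexive Wp≈c⋆ }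
    in x≤y+z⇒x-y≤z (begin
      V⋆                                      ≈⟨ Vz≈V⋆ ⟨
      value ⊤ z                               ≤⟨ Vz≤ ⟩
      value ⊤ (fill k⋆ p) + ω * C             ≈⟨ +-congʳ (∑-fill k⋆ vᵢ p) ⟩
      below + value Γ p + ω * C               ≤⟨ +-mono-≤ (+-mono-≤ ≤-refl Vp≤VΓ) ≤-refl ⟩
      below + VΓ + ω * C                      ≈⟨ +-congʳ (+-congˡ (y≈x+[y-x] (value Γ wf) VΓ)) ⟩
      below + (value Γ wf + ΔΓ VΓ) + ω * C
        ≈⟨ regroup below (value Γ wf) (ΔΓ VΓ) (ω * C) ⟩
      below + value Γ wf + (ΔΓ VΓ + ω * C)    ≈⟨ +-congʳ Vᵍᵖ≈ ⟨
      Vᵍᵖ + (ΔΓ VΓ + ω * C)                   ∎)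
    where
    regroup : ∀ b x d e → b + (x + d) + e ≈ b + x + (d + e)
    regroup = solve 4 (λ b x d e → b :+ (x :+ d) :+ e := b :+ x :+ (d :+ e)) refl

  ΔΓ≤ : ΔΓ VΓ ≤ ΔΓ-bound
  ΔΓ≤ =
    let z , z-feasible , Vz≈VΓ = IsKnapsackMax.attained VΓ-max
    in x≤y+z⇒x-y≤z (begin
      VΓ                      ≈⟨ Vz≈VΓ ⟨
      value Γ z               ≤⟨ intraGroupLoss≤ k⋆
        (λ i∈Γ → 0≤z z-feasible i∈Γ , z≤u z-feasible i∈Γ) (λ {i} _ → 0≤wf i , wf≤u i)
        (≤-trans (budget z-feasible) (≤-reflexive (sym level))) ⟩
      value Γ wf + ΔΓ-bound   ∎)

  E≤ΔΓ : ω ≈ 0# → E V⋆ ≤ ΔΓ VΓ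
  E≤ΔΓ ω≈0 = begin
    E V⋆            ≤⟨ E≤ ⟩
    ΔΓ VΓ + ω * C   ≈⟨ +-congˡ (trans (*-congʳ ω≈0) (zeroˡ C)) ⟩
    ΔΓ VΓ + 0#      ≈⟨ +-identityʳ _ ⟩
    ΔΓ VΓ           ∎
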